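{- Assume the plus principle. For every acyclic map $f : A \to B$ and every hypoabelian map $g : X \to Y$, $f$ is left orthogonal to $g$, i.e. $f \perp g$.
   Context: We work in homotopy type theory (HoTT) in the style of the HoTT Book: dependent type theory with univalent universes (hence function extensionality) and higher inductive types such as pushouts and truncations; no classical axioms are assumed. The suspension $\Sigma A$ of a type $A$ is the pushout of $\mathbf{1} \leftarrow A \to \mathbf{1}$. A type is acyclic if its suspension is contractible; a map is acyclic if all its fibers are acyclic types. A type is simply connected if its $1$-truncation is contractible. The plus principle is the statement that every acyclic and simply connected type is contractible. A group is perfect if its abelianization is trivial. A type $X$ is hypoabelian if for every $x : X$ every perfect subgroup of $\pi_1(X,x)$ is trivial (without propositional resizing, this is understood relative to a universe). A map is hypoabelian if all its fibers are hypoabelian. A map $f : A \to B$ is left orthogonal to a map $g : X \to Y$, written $f \perp g$, if for every commutative square from $f$ to $g$ the type of diagonal lifts $B \to X$ is contractible; equivalently, the square with corners $X^B, X^A, Y^B, Y^A$ and maps $f^*$ (precomposition with $f$) and $g_*$ (postcomposition with $g$) is a pullback square. -}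

{-# OPTIONS --without-K #-}
module Defs where

open import Level using (Level; _⊔_; suc; Setω)
open import Data.Nat using (ℕ)
open import Data.Product using (Σ; Σ-syntax; _,_; proj₁; proj₂)
open import Data.Sum using (_⊎_; inj₁; inj₂; [_,_])
open import Data.Unit using (⊤; tt)
open import Function using (id)
open import Relation.Binary.PropositionalEquality hiding ([_])
open import Algebra.Structures using (IsGroup; IsAbelianGroup)
import Algebra.Bundles as Bundles
import Algebra.Properties.Group as GroupProperties

private
  variable
    a b c p ℓ : Level

isContr : Set a → Set a
isContr A = Σ[ x ∈ A ] (∀ y → x ≡ y)

isProp : Set a → Set a
isProp A = (x y : A) → x ≡ y

-- An n-type is a type of h-level n + 2.
isOfHLevel : ℕ → Set a → Set a
isOfHLevel 0 A = isContr A
isOfHLevel 1 A = isProp A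
isOfHLevel (ℕ.suc (ℕ.suc n)) A = (x y : A) → isOfHLevel (ℕ.suc n) (x ≡ y)

isSet : Set a → Set a
isSet = isOfHLevel 2

isProp→isSet : {A : Set a} → isProp A → isSet A
isProp→isSet h x y p q = trans (lemma p) (sym (lemma q))
  where
  lemma : ∀ {z} (r : x ≡ z) → r ≡ trans (sym (h x x)) (h x z)
  lemma refl = sym (trans-symˡ (h x x))

subst-const : {A : Set a} {B : Set b} {x y : A} (q : x ≡ y) {z : B} →
              subst (λ _ → B) q z ≡ z
subst-const refl = refl

fiber : {A : Set a} {B : Set b} → (A → B) → B → Set (a ⊔ b)
fiber {A = A} f y = Σ[ x ∈ A ] f x ≡ y

isEquiv : {A : Set a} {B : Set b} → (A → B) → Set (a ⊔ b)
isEquiv f = ∀ y → isContr (fiber f y)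

_≃_ : Set a → Set b → Set (a ⊔ b)
A ≃ B = Σ[ f ∈ (A → B) ] isEquiv f

idEquiv : (A : Set a) → A ≃ A
idEquiv A = id , λ y → (y , refl) , λ { (_ , refl) → refl }

idToEquiv : {A B : Set a} → A ≡ B → A ≃ B
idToEquiv refl = idEquiv _

-- Consistent only without K, whence the option on this module.
Univalence : (ℓ : Level) → Set (suc ℓ)
Univalence ℓ = (A B : Set ℓ) → isEquiv (idToEquiv {A = A} {B = B})

-- Agda without cubical features has no higher inductive types, so closure of
-- the universes under pushouts and truncations is packaged as a structure:
-- formation, constructors, dependent elimination into every universe, and
-- computation rules up to identity (rather than judgmentally).
record HITs : Setω where
  field
    Pushout : {A : Set a} {B : Set b} {C : Set c} →
              (C → A) → (C → B) → Set (a ⊔ b ⊔ c)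
    inl : {A : Set a} {B : Set b} {C : Set c} {f : C → A} {g : C → B} →
          A → Pushout f g
    inr : {A : Set a} {B : Set b} {C : Set c} {f : C → A} {g : C → B} →
          B → Pushout f g
    glue : {A : Set a} {B : Set b} {C : Set c} {f : C → A} {g : C → B} →
           (z : C) → inl {f = f} {g = g} (f z) ≡ inr (g z)
    pushout-elim :
      {A : Set a} {B : Set b} {C : Set c} {f : C → A} {g : C → B}
      (P : Pushout f g → Set p)
      (l : (x : A) → P (inl x)) (r : (y : B) → P (inr y)) →
      ((z : C) → subst P (glue z) (l (f z)) ≡ r (g z)) →
      (x : Pushout f g) → P x
    pushout-inl :
      {A : Set a} {B : Set b} {C : Set c} {f : C → A} {g : C → B}
      (P : Pushout f g → Set p)
      (l : (x : A) → P (inl x)) (r : (y : B) → P (inr y))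
      (s : (z : C) → subst P (glue z) (l (f z)) ≡ r (g z)) →
      (x : A) → pushout-elim P l r s (inl x) ≡ l x
    pushout-inr :
      {A : Set a} {B : Set b} {C : Set c} {f : C → A} {g : C → B}
      (P : Pushout f g → Set p)
      (l : (x : A) → P (inl x)) (r : (y : B) → P (inr y))
      (s : (z : C) → subst P (glue z) (l (f z)) ≡ r (g z)) →
      (y : B) → pushout-elim P l r s (inr y) ≡ r y
    pushout-glue :
      {A : Set a} {B : Set b} {C : Set c} {f : C → A} {g : C → B}
      (P : Pushout f g → Set p)
      (l : (x : A) → P (inl x)) (r : (y : B) → P (inr y))
      (s : (z : C) → subst P (glue z) (l (f z)) ≡ r (g z)) →
      (z : C) →
      dcong (pushout-elim P l r s) (glue z) ≡
        trans (cong (subst P (glue z)) (pushout-inl P l r s (f z)))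
              (trans (s z) (sym (pushout-inr P l r s (g z))))

    -- The truncation is indexed by h-level: Trunc 2 is the 0-truncation.
    Trunc : ℕ → Set a → Set a
    ∣_∣ : {n : ℕ} {A : Set a} → A → Trunc n A
    trunc-hlevel : (n : ℕ) (A : Set a) → isOfHLevel n (Trunc n A)
    trunc-elim : {n : ℕ} {A : Set a} (P : Trunc n A → Set p) →
                 (∀ x → isOfHLevel n (P x)) →
                 ((x : A) → P ∣ x ∣) → (x : Trunc n A) → P x
    trunc-β : {n : ℕ} {A : Set a} (P : Trunc n A → Set p)
              (h : ∀ x → isOfHLevel n (P x)) (k : (x : A) → P ∣ x ∣) →
              (x : A) → trunc-elim P h k ∣ x ∣ ≡ k x

open HITs ⦃ ... ⦄ public

module _ ⦃ hits : HITs ⦄ where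

  Susp : Set a → Set a
  Susp A = Pushout {C = A} (λ _ → tt) (λ _ → tt)

  isAcyclic : Set a → Set a
  isAcyclic A = isContr (Susp A)

  isAcyclicMap : {A : Set a} {B : Set b} → (A → B) → Set (a ⊔ b)
  isAcyclicMap f = ∀ y → isAcyclic (fiber f y)

  isSimplyConnected : Set a → Set a
  isSimplyConnected A = isContr (Trunc 3 A)

  PlusPrinciple : (ℓ : Level) → Set (suc ℓ)
  PlusPrinciple ℓ = (A : Set ℓ) → isAcyclic A → isSimplyConnected A → isContr A

record Group (ℓ : Level) : Set (suc ℓ) where
  infixl 7 _∙_
  infix  8 _⁻¹
  field
    Carrier      : Set ℓ
    isSetCarrier : isSet Carrier
    _∙_          : Carrier → Carrier → Carrier
    ε            : Carrier
    _⁻¹          : Carrier → Carrier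
    isGroup      : IsGroup _≡_ _∙_ ε _⁻¹

  open IsGroup isGroup public using (assoc; identityˡ; identityʳ; inverseˡ; inverseʳ)

  bundle : Bundles.Group ℓ ℓ
  bundle = record { isGroup = isGroup }

isAbelian : Group ℓ → Set ℓ
isAbelian G = IsAbelianGroup _≡_ _∙_ ε _⁻¹
  where open Group G

isTrivial : Group ℓ → Set ℓ
isTrivial G = isContr (Group.Carrier G)

mkIsGroup : {A : Set ℓ} (_∙_ : A → A → A) (ε : A) (_⁻¹ : A → A) →
            (∀ x y z → (x ∙ y) ∙ z ≡ x ∙ (y ∙ z)) →
            (∀ x → ε ∙ x ≡ x) → (∀ x → x ∙ ε ≡ x) →
            (∀ x → (x ⁻¹) ∙ x ≡ ε) → (∀ x → x ∙ (x ⁻¹) ≡ ε) →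
            IsGroup _≡_ _∙_ ε _⁻¹
mkIsGroup _∙_ ε _⁻¹ as il ir vl vr = record
  { isMonoid = record
    { isSemigroup = record
      { isMagma = record { isEquivalence = isEquivalence ; ∙-cong = cong₂ _∙_ }
      ; assoc   = as }
    ; identity = il , ir }
  ; inverse = vl , vr
  ; ⁻¹-cong = cong _⁻¹ }

-- The predicate takes values in the same universe as the group.
record Subgroup (G : Group ℓ) : Set (suc ℓ) where
  open Group G
  field
    Member       : Carrier → Set ℓ
    isPropMember : ∀ x → isProp (Member x)
    ε-closed     : Member ε
    ∙-closed     : ∀ {x y} → Member x → Member y → Member (x ∙ y)
    ⁻¹-closed    : ∀ {x} → Member x → Member (x ⁻¹)

module _ {G : Group ℓ} (S : Subgroup G) where
  open Group G
  open Subgroup S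

  private
    El : Set ℓ
    El = Σ Carrier Member

    El≡ : {u v : El} → proj₁ u ≡ proj₁ v → u ≡ v
    El≡ {x , m} {_ , n} refl = cong (x ,_) (isPropMember x m n)

    El≡-η : {u v : El} (q : u ≡ v) → El≡ (cong proj₁ q) ≡ q
    El≡-η {x , m} refl = cong (cong (x ,_)) (isProp→isSet (isPropMember x) m m _ refl)

  subgroupGroup : Group ℓ
  subgroupGroup = record
    { Carrier      = El
    ; isSetCarrier = λ u v q r →
        trans (sym (El≡-η q))
          (trans (cong El≡ (isSetCarrier _ _ (cong proj₁ q) (cong proj₁ r))) (El≡-η r))
    ; _∙_          = λ (x , m) (y , n) → x ∙ y , ∙-closed m n
    ; ε            = ε , ε-closed
    ; _⁻¹          = λ (x , m) → x ⁻¹ , ⁻¹-closed m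
    ; isGroup      = mkIsGroup _ _ _
        (λ (x , _) (y , _) (z , _) → El≡ (assoc x y z))
        (λ (x , _) → El≡ (identityˡ x)) (λ (x , _) → El≡ (identityʳ x))
        (λ (x , _) → El≡ (inverseˡ x)) (λ (x , _) → El≡ (inverseʳ x))
    }

-- Membership in the subgroup [G, G] generated by the commutators.  This is not
-- proposition-valued, which is immaterial since it is only used to form a set
-- quotient.
data Derived (G : Group ℓ) : Group.Carrier G → Set ℓ where
  commutator : ∀ x y → let open Group G in Derived G (x ∙ y ∙ x ⁻¹ ∙ y ⁻¹)
  derived-ε  : Derived G (Group.ε G)
  derived-∙  : ∀ {x y} → Derived G x → Derived G y → Derived G (Group._∙_ G x y)
  derived-⁻¹ : ∀ {x} → Derived G x → Derived G (Group._⁻¹ G x)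

module _ ⦃ hits : HITs ⦄ where

  -- The set quotient, as the 0-truncation of the coequalizer of the two
  -- projections E ⇉ A; the coequalizer is the pushout of A ← E ⊎ E → E.
  module _ {A : Set ℓ} (R : A → A → Set ℓ) where

    private
      E : Set ℓ
      E = Σ[ x ∈ A ] Σ[ y ∈ A ] R x y

      endpoints : E ⊎ E → A
      endpoints = [ proj₁ , (λ e → proj₁ (proj₂ e)) ]

      fold : E ⊎ E → E
      fold = [ id , id ]

    Coequalizer : Set ℓ
    Coequalizer = Pushout endpoints fold

    _/_ : Set ℓ
    _/_ = Trunc 2 Coequalizer

    quot : A → _/_
    quot x = ∣ inl x ∣

    quot-≡ : ∀ {x y} → R x y → quot x ≡ quot y
    quot-≡ {x} {y} r =
      cong ∣_∣ (trans (glue (inj₁ (x , y , r))) (sym (glue (inj₂ (x , y , r)))))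

    isSet-/ : isSet _/_
    isSet-/ = trunc-hlevel 2 Coequalizer

    module _ {B : Set ℓ} (hB : isSet B) (k : A → B)
             (resp : ∀ {x y} → R x y → k x ≡ k y) where

      private
        coeqRec-glue : (e : E ⊎ E) →
          subst (λ (_ : Coequalizer) → B) (glue e) (k (endpoints e)) ≡ k (proj₁ (fold e))
        coeqRec-glue (inj₁ e) = subst-const (glue (inj₁ e))
        coeqRec-glue (inj₂ (x , y , r)) = trans (subst-const (glue (inj₂ (x , y , r)))) (sym (resp r))

        coeqRec : Coequalizer → B
        coeqRec = pushout-elim (λ _ → B) k (λ e → k (proj₁ e)) coeqRec-glue

      quot-rec : _/_ → B
      quot-rec = trunc-elim (λ _ → B) (λ _ → hB) coeqRec

      quot-rec-β : ∀ x → quot-rec (quot x) ≡ k x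
      quot-rec-β x = trans (trunc-β (λ _ → B) (λ _ → hB) coeqRec (inl x))
                           (pushout-inl (λ _ → B) k (λ e → k (proj₁ e)) coeqRec-glue x)

    quot-elimProp : (P : _/_ → Set ℓ) → (∀ x → isProp (P x)) →
                    (∀ x → P (quot x)) → ∀ x → P x
    quot-elimProp P hP k =
      trunc-elim P (λ x → isProp→isSet (hP x))
        (pushout-elim (λ x → P ∣ x ∣) k
          (λ e → subst (λ x → P ∣ x ∣) (glue (inj₁ e)) (k (proj₁ e)))
          (λ _ → hP _ _ _))

  module _ (G : Group ℓ) where
    open Group G
    open GroupProperties bundle using (⁻¹-anti-homo-∙; ⁻¹-involutive)
    open ≡-Reasoning

    SameCoset : Carrier → Carrier → Set ℓ
    SameCoset x y = Derived G (x ∙ y ⁻¹)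

    private
      cancelʳ : ∀ x y → x ∙ y ⁻¹ ∙ y ≡ x
      cancelʳ x y = trans (assoc x (y ⁻¹) y)
                      (trans (cong (x ∙_) (inverseˡ y)) (identityʳ x))

      cancelʳ′ : ∀ x y → x ∙ y ∙ y ⁻¹ ≡ x
      cancelʳ′ x y = trans (assoc x y (y ⁻¹))
                       (trans (cong (x ∙_) (inverseʳ y)) (identityʳ x))

      conj : ∀ x {y} → Derived G y → Derived G (x ∙ y ∙ x ⁻¹)
      conj x {y} d = subst (Derived G) (cancelʳ (x ∙ y ∙ x ⁻¹) y)
                       (derived-∙ (commutator x y) d)

      congˡ : ∀ {x x′} y → SameCoset x x′ → SameCoset (x ∙ y) (x′ ∙ y)
      congˡ {x} {x′} y = subst (Derived G) (sym (begin
        x ∙ y ∙ (x′ ∙ y) ⁻¹      ≡⟨ cong (x ∙ y ∙_) (⁻¹-anti-homo-∙ x′ y) ⟩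
        x ∙ y ∙ (y ⁻¹ ∙ x′ ⁻¹)   ≡⟨ assoc (x ∙ y) (y ⁻¹) (x′ ⁻¹) ⟨
        x ∙ y ∙ y ⁻¹ ∙ x′ ⁻¹     ≡⟨ cong (_∙ x′ ⁻¹) (cancelʳ′ x y) ⟩
        x ∙ x′ ⁻¹                ∎))

      congʳ : ∀ x {y y′} → SameCoset y y′ → SameCoset (x ∙ y) (x ∙ y′)
      congʳ x {y} {y′} d = subst (Derived G) (begin
        x ∙ (y ∙ y′ ⁻¹) ∙ x ⁻¹   ≡⟨ cong (_∙ x ⁻¹) (assoc x y (y′ ⁻¹)) ⟨
        x ∙ y ∙ y′ ⁻¹ ∙ x ⁻¹     ≡⟨ assoc (x ∙ y) (y′ ⁻¹) (x ⁻¹) ⟩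
        x ∙ y ∙ (y′ ⁻¹ ∙ x ⁻¹)   ≡⟨ cong (x ∙ y ∙_) (⁻¹-anti-homo-∙ x y′) ⟨
        x ∙ y ∙ (x ∙ y′) ⁻¹      ∎) (conj x d)

      cong⁻¹ : ∀ {x y} → SameCoset x y → SameCoset (x ⁻¹) (y ⁻¹)
      cong⁻¹ {x} {y} d = subst (Derived G) (begin
        (x ⁻¹ ∙ (x ∙ y ⁻¹) ∙ x ⁻¹ ⁻¹) ⁻¹   ≡⟨ cong (λ z → (z ∙ x ⁻¹ ⁻¹) ⁻¹) (assoc (x ⁻¹) x (y ⁻¹)) ⟨
        (x ⁻¹ ∙ x ∙ y ⁻¹ ∙ x ⁻¹ ⁻¹) ⁻¹     ≡⟨ cong (λ z → (z ∙ y ⁻¹ ∙ x ⁻¹ ⁻¹) ⁻¹) (inverseˡ x) ⟩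
        (ε ∙ y ⁻¹ ∙ x ⁻¹ ⁻¹) ⁻¹            ≡⟨ cong (λ z → (z ∙ x ⁻¹ ⁻¹) ⁻¹) (identityˡ (y ⁻¹)) ⟩
        (y ⁻¹ ∙ x ⁻¹ ⁻¹) ⁻¹                ≡⟨ cong (λ z → (y ⁻¹ ∙ z) ⁻¹) (⁻¹-involutive x) ⟩
        (y ⁻¹ ∙ x) ⁻¹                      ≡⟨ ⁻¹-anti-homo-∙ (y ⁻¹) x ⟩
        x ⁻¹ ∙ y ⁻¹ ⁻¹                     ∎) (derived-⁻¹ (conj (x ⁻¹) d))

      swap : ∀ x y → SameCoset (x ∙ y) (y ∙ x)
      swap x y = subst (Derived G) (begin
        x ∙ y ∙ x ⁻¹ ∙ y ⁻¹     ≡⟨ assoc (x ∙ y) (x ⁻¹) (y ⁻¹) ⟩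
        x ∙ y ∙ (x ⁻¹ ∙ y ⁻¹)   ≡⟨ cong (x ∙ y ∙_) (⁻¹-anti-homo-∙ y x) ⟨
        x ∙ y ∙ (y ∙ x) ⁻¹      ∎) (commutator x y)

      Ab : Set ℓ
      Ab = _/_ SameCoset

      ⟦_⟧ : Carrier → Ab
      ⟦_⟧ = quot SameCoset

      isSetAb : isSet Ab
      isSetAb = isSet-/ SameCoset

      elim≡ : (u v : Ab → Ab) → (∀ x → u ⟦ x ⟧ ≡ v ⟦ x ⟧) → ∀ x → u x ≡ v x
      elim≡ u v = quot-elimProp SameCoset (λ x → u x ≡ v x) (λ x → isSetAb (u x) (v x))

      left : Carrier → Ab → Ab
      left x = quot-rec SameCoset isSetAb (λ y → ⟦ x ∙ y ⟧)
                 (λ d → quot-≡ SameCoset (congʳ x d))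

      left-β : ∀ x y → left x ⟦ y ⟧ ≡ ⟦ x ∙ y ⟧
      left-β x = quot-rec-β SameCoset isSetAb (λ y → ⟦ x ∙ y ⟧)
                   (λ d → quot-≡ SameCoset (congʳ x d))

      left-resp : ∀ {x x′} → SameCoset x x′ → ∀ y → left x y ≡ left x′ y
      left-resp {x} {x′} d = elim≡ (left x) (left x′) λ y →
        trans (left-β x y)
          (trans (quot-≡ SameCoset (congˡ y d)) (sym (left-β x′ y)))

      infixl 7 _·_
      _·_ : Ab → Ab → Ab
      u · v = quot-rec SameCoset isSetAb (λ x → left x v) (λ d → left-resp d v) u

      ·-β : ∀ x y → ⟦ x ⟧ · ⟦ y ⟧ ≡ ⟦ x ∙ y ⟧
      ·-β x y = trans
        (quot-rec-β SameCoset isSetAb (λ z → left z ⟦ y ⟧) (λ d → left-resp d ⟦ y ⟧) x)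
        (left-β x y)

      inv : Ab → Ab
      inv = quot-rec SameCoset isSetAb (λ x → ⟦ x ⁻¹ ⟧) (λ d → quot-≡ SameCoset (cong⁻¹ d))

      inv-β : ∀ x → inv ⟦ x ⟧ ≡ ⟦ x ⁻¹ ⟧
      inv-β = quot-rec-β SameCoset isSetAb (λ x → ⟦ x ⁻¹ ⟧) (λ d → quot-≡ SameCoset (cong⁻¹ d))

      ·-assoc : ∀ u v w → (u · v) · w ≡ u · (v · w)
      ·-assoc u v w =
        elim≡ (λ u → (u · v) · w) (λ u → u · (v · w)) (λ x →
        elim≡ (λ v → (⟦ x ⟧ · v) · w) (λ v → ⟦ x ⟧ · (v · w)) (λ y →
        elim≡ (λ w → (⟦ x ⟧ · ⟦ y ⟧) · w) (λ w → ⟦ x ⟧ · (⟦ y ⟧ · w)) (λ z → begin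
          (⟦ x ⟧ · ⟦ y ⟧) · ⟦ z ⟧   ≡⟨ cong (_· ⟦ z ⟧) (·-β x y) ⟩
          ⟦ x ∙ y ⟧ · ⟦ z ⟧         ≡⟨ ·-β (x ∙ y) z ⟩
          ⟦ x ∙ y ∙ z ⟧             ≡⟨ cong ⟦_⟧ (assoc x y z) ⟩
          ⟦ x ∙ (y ∙ z) ⟧           ≡⟨ ·-β x (y ∙ z) ⟨
          ⟦ x ⟧ · ⟦ y ∙ z ⟧         ≡⟨ cong (⟦ x ⟧ ·_) (·-β y z) ⟨
          ⟦ x ⟧ · (⟦ y ⟧ · ⟦ z ⟧)   ∎) w) v) u

      ·-comm : ∀ u v → u · v ≡ v · u
      ·-comm u v =
        elim≡ (λ u → u · v) (λ u → v · u) (λ x →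
        elim≡ (λ v → ⟦ x ⟧ · v) (λ v → v · ⟦ x ⟧) (λ y →
          trans (·-β x y) (trans (quot-≡ SameCoset (swap x y)) (sym (·-β y x)))) v) u

      ·-identityˡ : ∀ u → ⟦ ε ⟧ · u ≡ u
      ·-identityˡ = elim≡ (⟦ ε ⟧ ·_) id λ x → trans (·-β ε x) (cong ⟦_⟧ (identityˡ x))

      ·-inverseˡ : ∀ u → inv u · u ≡ ⟦ ε ⟧
      ·-inverseˡ = elim≡ (λ u → inv u · u) (λ _ → ⟦ ε ⟧) λ x →
        trans (cong (_· ⟦ x ⟧) (inv-β x))
          (trans (·-β (x ⁻¹) x) (cong ⟦_⟧ (inverseˡ x)))

    abelianization : Group ℓ
    abelianization = record
      { Carrier      = Ab
      ; isSetCarrier = isSetAb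
      ; _∙_          = _·_
      ; ε            = ⟦ ε ⟧
      ; _⁻¹          = inv
      ; isGroup      = mkIsGroup _·_ ⟦ ε ⟧ inv ·-assoc
          ·-identityˡ (λ u → trans (·-comm u ⟦ ε ⟧) (·-identityˡ u))
          ·-inverseˡ (λ u → trans (·-comm u (inv u)) (·-inverseˡ u))
      }

    abelianization-isAbelian : isAbelian abelianization
    abelianization-isAbelian =
      record { isGroup = Group.isGroup abelianization ; comm = ·-comm }

  isPerfect : Group ℓ → Set ℓ
  isPerfect G = isTrivial (abelianization G)

  module _ (X : Set ℓ) (x : X) where

    private
      π : Set ℓ
      π = Trunc 2 (x ≡ x)

      isSetπ : isSet π
      isSetπ = trunc-hlevel 2 (x ≡ x)

      lift₁ : (x ≡ x → π) → π → π
      lift₁ = trunc-elim (λ _ → π) (λ _ → isSetπ)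

      lift₁-β : (k : x ≡ x → π) → ∀ p → lift₁ k ∣ p ∣ ≡ k p
      lift₁-β = trunc-β (λ _ → π) (λ _ → isSetπ)

      elim≡π : (u v : π → π) → (∀ p → u ∣ p ∣ ≡ v ∣ p ∣) → ∀ s → u s ≡ v s
      elim≡π u v = trunc-elim (λ s → u s ≡ v s) (λ s → isProp→isSet (isSetπ (u s) (v s)))

      infixl 7 _·_
      _·_ : π → π → π
      s · t = lift₁ (λ p → lift₁ (λ q → ∣ trans p q ∣) t) s

      ·-β : ∀ p q → ∣ p ∣ · ∣ q ∣ ≡ ∣ trans p q ∣
      ·-β p q = trans (lift₁-β (λ p → lift₁ (λ q → ∣ trans p q ∣) ∣ q ∣) p)
                      (lift₁-β (λ q → ∣ trans p q ∣) q)

      inv : π → π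
      inv = lift₁ (λ p → ∣ sym p ∣)

      inv-β : ∀ p → inv ∣ p ∣ ≡ ∣ sym p ∣
      inv-β = lift₁-β (λ p → ∣ sym p ∣)

      open ≡-Reasoning

      ·-assoc : ∀ s t u → (s · t) · u ≡ s · (t · u)
      ·-assoc s t u =
        elim≡π (λ s → (s · t) · u) (λ s → s · (t · u)) (λ p →
        elim≡π (λ t → (∣ p ∣ · t) · u) (λ t → ∣ p ∣ · (t · u)) (λ q →
        elim≡π (λ u → (∣ p ∣ · ∣ q ∣) · u) (λ u → ∣ p ∣ · (∣ q ∣ · u)) (λ r → begin
          (∣ p ∣ · ∣ q ∣) · ∣ r ∣   ≡⟨ cong (_· ∣ r ∣) (·-β p q) ⟩
          ∣ trans p q ∣ · ∣ r ∣     ≡⟨ ·-β (trans p q) r ⟩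
          ∣ trans (trans p q) r ∣   ≡⟨ cong ∣_∣ (trans-assoc p) ⟩
          ∣ trans p (trans q r) ∣   ≡⟨ ·-β p (trans q r) ⟨
          ∣ p ∣ · ∣ trans q r ∣     ≡⟨ cong (∣ p ∣ ·_) (·-β q r) ⟨
          ∣ p ∣ · (∣ q ∣ · ∣ r ∣)   ∎) u) t) s

    π₁ : Group ℓ
    π₁ = record
      { Carrier      = π
      ; isSetCarrier = isSetπ
      ; _∙_          = _·_
      ; ε            = ∣ refl ∣
      ; _⁻¹          = inv
      ; isGroup      = mkIsGroup _·_ ∣ refl ∣ inv ·-assoc
          (elim≡π (∣ refl ∣ ·_) id λ p → ·-β refl p)
          (elim≡π (_· ∣ refl ∣) id λ p →
            trans (·-β p refl) (cong ∣_∣ (trans-reflʳ p)))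
          (elim≡π (λ s → inv s · s) (λ _ → ∣ refl ∣) λ p →
            trans (cong (_· ∣ p ∣) (inv-β p))
              (trans (·-β (sym p) p) (cong ∣_∣ (trans-symˡ p))))
          (elim≡π (λ s → s · inv s) (λ _ → ∣ refl ∣) λ p →
            trans (cong (∣ p ∣ ·_) (inv-β p))
              (trans (·-β p (sym p)) (cong ∣_∣ (trans-symʳ p))))
      }

  isHypoabelian : Set ℓ → Set (suc ℓ)
  isHypoabelian X = (x : X) (S : Subgroup (π₁ X x)) →
                    isPerfect (subgroupGroup S) → isTrivial (subgroupGroup S)

  isHypoabelianMap : {X Y : Set ℓ} → (X → Y) → Set (suc ℓ)
  isHypoabelianMap g = ∀ y → isHypoabelian (fiber g y)

-- Lifts for the square with top u, bottom v and homotopy σ : g ∘ u ~ v ∘ f: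
-- both triangles commute, and pasting them gives back σ.
DiagonalLift : {A B X Y : Set ℓ} (f : A → B) (g : X → Y)
               (u : A → X) (v : B → Y) → (∀ x → g (u x) ≡ v (f x)) → Set ℓ
DiagonalLift {A = A} {B = B} {X = X} f g u v σ =
  Σ[ d ∈ (B → X) ]
  Σ[ upper ∈ (∀ x → u x ≡ d (f x)) ]
  Σ[ lower ∈ (∀ y → g (d y) ≡ v y) ]
  (∀ x → trans (cong g (upper x)) (lower (f x)) ≡ σ x)

infix 4 _⊥_
_⊥_ : {A B X Y : Set ℓ} → (A → B) → (X → Y) → Set ℓ
_⊥_ {A = A} {B = B} {X = X} {Y = Y} f g =
  (u : A → X) (v : B → Y) (σ : ∀ x → g (u x) ≡ v (f x)) →
  isContr (DiagonalLift f g u v σ)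

{-# OPTIONS --without-K #-}

-- Working fibrewise, it suffices that every u : A → X from an acyclic type to a
-- hypoabelian one is constant; constancy data is then unique, because A also
-- sees the identity types of X as constant.  Let Q be the cofiber of u and
-- j : X → Q the inclusion, whose fibers F are acyclic.  The image of π₁(F) in
-- π₁(X) is perfect, hence trivial, so π₁(F) is a quotient of π₂(Q), hence
-- central.  Being also perfect it vanishes, so F is contractible by the plus
-- principle.  Thus j is an equivalence, and u is constant because j ∘ u is.
--
-- All consequences of acyclicity are drawn from a single one: a family of
-- identifications x ≡ y indexed by an acyclic type is constant.  By univalence
-- this applies to families of equivalences between two fixed types.

module Submission where

open import Level using (Level; _⊔_; Lift; lift; lower) renaming (suc to lsuc)
open import Axiom.UniquenessOfIdentityProofs using (module Constant⇒UIP)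
open import Data.List using (List; []; _∷_; _++_)
open import Data.List.Properties using (∷-injectiveˡ)
open import Data.List.Relation.Binary.Permutation.Propositional
  using (_↭_; prep; ↭-refl; ↭-sym; ↭-trans)
open import Data.List.Relation.Binary.Permutation.Propositional.Properties
  using (++-comm; ++⁺ʳ; drop-mid; shift; ↭-singleton-inv)
open import Data.Product using (Σ; Σ-syntax; _×_; _,_; proj₁; proj₂)
open import Data.Unit using (⊤; tt)
open import Function using (id; _∘_)
open import Relation.Binary.PropositionalEquality
import Algebra.Properties.Group as GroupProperties
open import Algebra.Structures using (IsAbelianGroup)
open import Defs

private
  variable
    a b ℓ κ : Level

-- Contractible types, sets and equivalences.

isContr→isProp : {A : Set a} → isContr A → isProp A
isContr→isProp (_ , h) x y = trans (sym (h x)) (h y)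

isContr-retract : {A : Set a} {B : Set b} (r : A → B) (s : B → A) →
                  (∀ y → r (s y) ≡ y) → isContr A → isContr B
isContr-retract r s rs (x , h) = r x , λ y → trans (cong r (h (s y))) (rs y)

isContr-singleton : {A : Set a} {x : A} → isContr (Σ[ y ∈ A ] x ≡ y)
isContr-singleton = (_ , refl) , λ { (_ , refl) → refl }

-- Hedberg's argument: `inj (cong f p)` does not depend on `p` because `B` is a set, and a constant
-- endomap of the identity types makes them propositions.
isSet-injective : {A : Set a} {B : Set b} → isSet B → (f : A → B) →
                  (∀ {x y} → f x ≡ f y → x ≡ y) → isSet A
isSet-injective hB f inj _ _ =
  Constant⇒UIP.≡-irrelevant (λ p → inj (cong f p))
    (λ p q → cong inj (hB _ _ (cong f p) (cong f q)))

Σ≡Prop : {A : Set a} {P : A → Set b} → (∀ x → isProp (P x)) →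
         {u v : Σ A P} → proj₁ u ≡ proj₁ v → u ≡ v
Σ≡Prop h {x , m} {_ , n} refl = cong (x ,_) (h x m n)

isSet-ΣProp : {A : Set a} {P : A → Set b} → isSet A → (∀ x → isProp (P x)) →
              isSet (Σ A P)
isSet-ΣProp hA hP = isSet-injective hA proj₁ (Σ≡Prop hP)

isProp-× : {A : Set a} {B : Set b} → isProp A → isProp B → isProp (A × B)
isProp-× hA hB (x , y) (x′ , y′) = cong₂ _,_ (hA x x′) (hB y y′)

-- The fiber over `y` is a retract of the singleton at `y`. The path in `s` is corrected by `η` and
-- `θ`, which replaces a coherence between the two.
inverse→isEquiv : {A : Set a} {B : Set b} (f : A → B) (g : B → A) →
                  (∀ x → g (f x) ≡ x) → (∀ y → f (g y) ≡ y) → isEquiv f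
inverse→isEquiv {A = A} {B = B} f g η θ y = isContr-retract r s rs isContr-singleton
  where
  r : Σ[ z ∈ B ] y ≡ z → fiber f y
  r (z , p) = g z , trans (θ z) (sym p)

  s : fiber f y → Σ[ z ∈ B ] y ≡ z
  s (x , p) = f x , sym (trans (sym (θ (f x))) (trans (cong f (η x)) p))

  cancel : ∀ {u v w : B} (p : u ≡ v) (q : u ≡ w) → trans p (sym (sym (trans (sym p) q))) ≡ q
  cancel refl refl = refl

  shift-η : ∀ {x x′} (p : x′ ≡ x) (q : f x ≡ y) →
            _≡_ {A = fiber f y} (x′ , trans (cong f p) q) (x , q)
  shift-η refl _ = refl

  rs : ∀ w → r (s w) ≡ w
  rs (x , p) = trans (cong (g (f x) ,_) (cancel (θ (f x)) _)) (shift-η (η x) p)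

isProp→isEquiv : {A : Set a} {B : Set b} → isProp A → isProp B →
                 (f : A → B) → (B → A) → isEquiv f
isProp→isEquiv hA hB f g = inverse→isEquiv f g (λ _ → hA _ _) (λ _ → hB _ _)

-- Transport goes through `C`: from `x` to `z` it is `K x` followed by the inverse of `K z`, and
-- these cancel on a loop.
transport-constant : {A : Set a} {Y : A → Set b} {C : Set b} → (∀ x → Y x ≡ C) →
                     ∀ {x} (p : x ≡ x) (y : Y x) → subst Y p y ≡ y
transport-constant {Y = Y} K {x} p y =
  trans (transport p y) (cong (λ q → subst id q y) (trans-symʳ (K x)))
  where
  transport : ∀ {z} (p : x ≡ z) (y : Y x) → subst Y p y ≡ subst id (trans (K x) (sym (K z))) y
  transport refl y = cong (λ q → subst id q y) (sym (trans-symʳ (K x)))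

IsConstant : {A : Set a} {B : Set b} → (A → B) → Set (a ⊔ b)
IsConstant {B = B} k = Σ[ y ∈ B ] (∀ x → k x ≡ y)

-- Function extensionality and the set of propositions, from univalence.

module Extensionality (univalence : (κ : Level) → Univalence κ) where

  ua : {A B : Set κ} → A ≃ B → A ≡ B
  ua e = proj₁ (proj₁ (univalence _ _ _ e))

  ua-β : {A B : Set κ} (e : A ≃ B) → idToEquiv (ua e) ≡ e
  ua-β e = proj₂ (proj₁ (univalence _ _ _ e))

  private
    postcompose-isEquiv : {A B C : Set κ} (e : A ≃ B) →
                          isEquiv (λ (h : C → A) → proj₁ e ∘ h)
    postcompose-isEquiv {A = A} {C = C} e =
      subst (λ e → isEquiv (λ (h : C → A) → proj₁ e ∘ h)) (ua-β e) (path (ua e))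
      where
      path : ∀ {B} (q : A ≡ B) → isEquiv (λ (h : C → A) → proj₁ (idToEquiv q) ∘ h)
      path refl = proj₂ (idEquiv (C → A))

    -- Sections of `P` are a retract of the fiber over `id` of postcomposition with the equivalence
    -- `proj₁ : Σ A P → A`.
    weak-funext : {A : Set κ} {P : A → Set κ} → (∀ x → isContr (P x)) → isContr (∀ x → P x)
    weak-funext {A = A} {P = P} h =
      isContr-retract (λ { (k , q) x → subst P (cong-app q x) (proj₂ (k x)) })
        (λ k → (λ x → x , k x) , refl) (λ _ → refl)
        (postcompose-isEquiv {C = A} (proj₁ , proj₁-isEquiv) id)
      where
      proj₁-isEquiv : isEquiv {A = Σ A P} proj₁
      proj₁-isEquiv = inverse→isEquiv proj₁ (λ x → x , proj₁ (h x))
        (λ { (x , y) → cong (x ,_) (proj₂ (h x) y) }) (λ _ → refl)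

    funext-homogeneous : {A : Set κ} {P : A → Set κ} {f g : ∀ x → P x} →
                         (∀ x → f x ≡ g x) → f ≡ g
    funext-homogeneous {f = f} {g = g} H =
      cong (λ k x → proj₁ (k x))
        (isContr→isProp (weak-funext (λ x → isContr-singleton {x = f x}))
          (λ x → f x , refl) (λ x → g x , H x))

  funext : {A : Set a} {P : A → Set b} {f g : ∀ x → P x} → (∀ x → f x ≡ g x) → f ≡ g
  funext {a = a} {b = b} {A = A} {P = P} {f = f} {g = g} H =
    cong (λ k x → lower (k (lift x)))
      (funext-homogeneous {A = Lift b A} {P = λ x → Lift a (P (lower x))}
        {f = λ x → lift (f (lower x))} {g = λ x → lift (g (lower x))}
        (λ x → cong lift (H (lower x))))

  isProp-Π : {A : Set a} {P : A → Set b} → (∀ x → isProp (P x)) → isProp (∀ x → P x)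
  isProp-Π h f g = funext λ x → h x (f x) (g x)

  isContr-Π : {A : Set a} {P : A → Set b} → (∀ x → isContr (P x)) → isContr (∀ x → P x)
  isContr-Π h = (λ x → proj₁ (h x)) , λ k → funext λ x → proj₂ (h x) (k x)

  isProp-isProp : {A : Set a} → isProp (isProp A)
  isProp-isProp h h′ = isProp-Π (λ x → isProp-Π (λ y → isProp→isSet h x y)) h h′

  isProp-isSet : {A : Set a} → isProp (isSet A)
  isProp-isSet = isProp-Π λ _ → isProp-Π λ _ → isProp-isProp

  isProp-isContr : {A : Set a} → isProp (isContr A)
  isProp-isContr c c′ =
    Σ≡Prop (λ x → isProp-Π (λ y → isProp→isSet (isContr→isProp c) x y)) (proj₂ c (proj₁ c′))

  isSet-Π : {A : Set a} {P : A → Set b} → (∀ x → isSet (P x)) → isSet (∀ x → P x)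
  isSet-Π h _ _ =
    Constant⇒UIP.≡-irrelevant (λ p → funext (cong-app p))
      (λ p q → cong funext (funext λ x → h x _ _ (cong-app p x) (cong-app q x)))

  hProp : (ℓ : Level) → Set (lsuc ℓ)
  hProp ℓ = Σ[ P ∈ Set ℓ ] isProp P

  hProp-≡ : {P Q : hProp ℓ} → (proj₁ P → proj₁ Q) → (proj₁ Q → proj₁ P) → P ≡ Q
  hProp-≡ {P = P} {Q = Q} f g =
    Σ≡Prop (λ _ → isProp-isProp) (ua (f , isProp→isEquiv (proj₂ P) (proj₂ Q) f g))

  -- Hedberg again: a path rebuilt from its two transports is independent of the path, since maps
  -- into a proposition form a proposition.
  isSet-hProp : isSet (hProp ℓ)
  isSet-hProp _ _ =
    Constant⇒UIP.≡-irrelevant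
      (λ q → hProp-≡ (subst proj₁ q) (subst proj₁ (sym q)))
      (λ { {P} {Q} _ _ → cong₂ hProp-≡
        (isProp-Π (λ _ → proj₂ Q) _ _) (isProp-Π (λ _ → proj₂ P) _ _) })

-- Constancy of families indexed by an acyclic type.

dcong-nondependent :
  {A : Set a} {B : Set b} (h : A → B) {s t : A} (p : s ≡ t) {x y : B}
  (u : h s ≡ x) (v : h t ≡ y) (σ : subst (λ _ → B) p x ≡ y) →
  dcong h p ≡ trans (cong (subst (λ _ → B) p) u) (trans σ (sym v)) →
  trans (sym (subst-const p)) σ ≡ trans (sym u) (trans (cong h p) v)
dcong-nondependent h refl refl refl σ e = trans (sym (trans-reflʳ σ)) (sym e)

subst-≡ʳ : {A : Set a} {x y z : A} (p : y ≡ z) (q : x ≡ y) → subst (x ≡_) p q ≡ trans q p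
subst-≡ʳ refl q = sym (trans-reflʳ q)

module Acyclic ⦃ hits : HITs ⦄ (univalence : (κ : Level) → Univalence κ) where

  open Extensionality univalence

  -- `k` is the glue data of a map `h : Susp A → B`. All paths `glue z` agree in the contractible
  -- type `Susp A`, hence so do their images under `h`, which are the `k z` up to computation rules.
  path-constant : {A : Set a} → isAcyclic A → {B : Set b} {x y : B} (k : A → x ≡ y) →
                  IsConstant k
  path-constant {A = A} (N , c) {B} {x} {y} k = trans (sym βˡ) (trans (cong h q) βʳ) , constant
    where
    P : Susp A → Set _
    P _ = B

    coh : ∀ z → subst P (glue z) x ≡ y
    coh z = trans (subst-const (glue z)) (k z)

    h : Susp A → B
    h = pushout-elim P (λ _ → x) (λ _ → y) coh

    βˡ : h (inl tt) ≡ x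
    βˡ = pushout-inl P (λ _ → x) (λ _ → y) coh tt

    βʳ : h (inr tt) ≡ y
    βʳ = pushout-inr P (λ _ → x) (λ _ → y) coh tt

    q : inl tt ≡ inr tt
    q = trans (sym (c (inl tt))) (c (inr tt))

    cancel : ∀ {u v w : B} (p : u ≡ v) (r : v ≡ w) → trans (sym p) (trans p r) ≡ r
    cancel refl _ = refl

    open ≡-Reasoning

    constant : ∀ z → k z ≡ trans (sym βˡ) (trans (cong h q) βʳ)
    constant z = begin
      k z                                         ≡⟨ cancel (subst-const (glue z)) (k z) ⟨
      trans (sym (subst-const (glue z))) (coh z)  ≡⟨ dcong-nondependent h (glue z) βˡ βʳ (coh z)
                                                      (pushout-glue P (λ _ → x) (λ _ → y) coh z) ⟩
      trans (sym βˡ) (trans (cong h (glue z)) βʳ) ≡⟨ cong (λ r → trans (sym βˡ) (trans (cong h r) βʳ))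
                                                      (isProp→isSet (isContr→isProp (N , c)) _ _ (glue z) q) ⟩
      trans (sym βˡ) (trans (cong h q) βʳ)        ∎

  IsConstant-contr : {A : Set a} → isAcyclic A → {B : Set b} {u : A → B} →
                     IsConstant u → isContr (IsConstant u)
  IsConstant-contr {A = A} hA {B} {u} (x , H) = (x , H) , λ (x′ , H′) →
    let (r , R) = path-constant hA (λ z → trans (sym (H z)) (H′ z)) in unique r H′ R
    where
    cancel : {v w : B} (p q : v ≡ w) → trans (sym p) q ≡ refl → p ≡ q
    cancel refl _ e = sym e

    unique : ∀ {x′} (r : x ≡ x′) (H′ : ∀ z → u z ≡ x′) →
             (∀ z → trans (sym (H z)) (H′ z) ≡ r) → (x , H) ≡ (x′ , H′)
    unique refl H′ R = cong (x ,_) (funext λ z → cancel (H z) (H′ z) (R z))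

  equiv-constant : {A : Set a} → isAcyclic A → {C D : Set κ} (e : A → C → D) →
                   (∀ x → isEquiv (e x)) → IsConstant e
  equiv-constant hA e h =
    let (q , H) = path-constant hA (λ x → ua (e x , h x))
    in proj₁ (idToEquiv q) , λ x →
         trans (sym (cong proj₁ (ua-β (e x , h x)))) (cong (proj₁ ∘ idToEquiv) (H x))

  -- Contracting the suspension of a fiber takes a path `inl tt ≡ inr tt` that equals every
  -- `glue w`. It is built by induction on `q`; the compatibility over `glue z` asks for a family of
  -- paths indexed by `A` to be constant.
  cofiber-inl-acyclic : {A : Set a} {X : Set b} → isAcyclic A → (u : A → X) →
                        isAcyclicMap (inl {f = u} {g = λ _ → tt})
  cofiber-inl-acyclic {A = A} {X = X} hA u q = inl tt ,
    pushout-elim (inl tt ≡_) (λ _ → refl) (λ _ → section q)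
      (λ w → trans (subst-≡ʳ (glue w) refl) (glue≡section q w))
    where
    Q : Set _
    Q = Pushout u (λ _ → tt)

    L : Q → Set _
    L q = _≡_ {A = Susp (fiber inl q)} (inl tt) (inr tt)

    at-inl : ∀ x → L (inl x)
    at-inl x = glue (x , refl)

    at-inr : IsConstant (λ z → subst L (glue z) (at-inl (u z)))
    at-inr = path-constant hA (λ z → subst L (glue z) (at-inl (u z)))

    section : ∀ q → L q
    section = pushout-elim L at-inl (λ _ → proj₁ at-inr) (proj₂ at-inr)

    glue≡section : ∀ q (w : fiber inl q) → glue w ≡ section q
    glue≡section _ (x , refl) = sym (pushout-inl L at-inl (λ _ → proj₁ at-inr) (proj₂ at-inr) x)

  -- Constancy data contain a value even when no index is at hand. Each `x : A` makes the map from
  -- the unit type to `Trunc 1 A` an equivalence, and the common value of these maps gives the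
  -- element.
  acyclic-inhabited : {A : Set a} → isAcyclic A → Trunc 1 A
  acyclic-inhabited {a = a} {A = A} hA =
    proj₁ (equiv-constant hA {C = Lift a ⊤} {D = Trunc 1 A} (λ x _ → ∣ x ∣)
      (λ x → isProp→isEquiv (λ _ _ → refl) (trunc-hlevel 1 A) _ (λ _ → lift tt))) (lift tt)

  trunc₁-rec : {A : Set a} {P : Set b} → isProp P → (A → P) → Trunc 1 A → P
  trunc₁-rec h = trunc-elim (λ _ → _) (λ _ → h)

  trunc₁-map : {A : Set a} {B : Set b} → (A → B) → Trunc 1 A → Trunc 1 B
  trunc₁-map f = trunc₁-rec (trunc-hlevel 1 _) (λ x → ∣ f x ∣)

  -- Acyclic types are connected.

  module _ (A : Set a) where

    private
      -- The pair `(m , n)` stands for the formal difference of two multisets. Multisets are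
      -- cancellative (`drop-++`), so `_~_` needs no auxiliary summand.
      Difference : Set a
      Difference = List A × List A

      infix 4 _~_
      _~_ : Difference → Difference → Set a
      (m , n) ~ (m′ , n′) = m ++ n′ ↭ m′ ++ n

      -- Subsets of the Grothendieck group of the free commutative monoid on A.
      Invariant : Set (lsuc a)
      Invariant = Σ[ φ ∈ (Difference → hProp a) ]
                    (∀ d d′ → d ~ d′ → proj₁ (φ d) → proj₁ (φ d′))

      Invariant-≡ : {φ ψ : Invariant} →
                    (∀ d → proj₁ (proj₁ φ d) → proj₁ (proj₁ ψ d)) →
                    (∀ d → proj₁ (proj₁ ψ d) → proj₁ (proj₁ φ d)) → φ ≡ ψ
      Invariant-≡ f g = Σ≡Prop
        (λ φ → isProp-Π λ _ → isProp-Π λ d → isProp-Π λ _ → isProp-Π λ _ → proj₂ (φ d))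
        (funext λ d → hProp-≡ (f d) (g d))

      shift⁺ : A → Invariant → Invariant
      shift⁺ x (φ , inv) = (λ (m , n) → φ (x ∷ m , n)) , λ _ _ r → inv _ _ (prep x r)

      shift⁻ : A → Invariant → Invariant
      shift⁻ x (φ , inv) = (λ (m , n) → φ (m , x ∷ n)) , λ (m , n) (m′ , n′) r →
        inv _ _ (↭-trans (shift x m n′) (↭-trans (prep x r) (↭-sym (shift x m′ n))))

      cancel : ∀ x m n → (x ∷ m , x ∷ n) ~ (m , n)
      cancel x m n = ↭-sym (shift x m n)

      shift⁺-isEquiv : ∀ x → isEquiv (shift⁺ x)
      shift⁺-isEquiv x = inverse→isEquiv (shift⁺ x) (shift⁻ x)
        (λ φ → Invariant-≡ (contract φ) (expand φ)) (λ φ → Invariant-≡ (contract φ) (expand φ))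
        where
        contract : ∀ φ ((m , n) : Difference) →
                   proj₁ (proj₁ φ (x ∷ m , x ∷ n)) → proj₁ (proj₁ φ (m , n))
        contract (_ , inv) (m , n) = inv _ _ (cancel x m n)

        expand : ∀ φ ((m , n) : Difference) →
                 proj₁ (proj₁ φ (m , n)) → proj₁ (proj₁ φ (x ∷ m , x ∷ n))
        expand (_ , inv) (m , n) = inv _ _ (↭-sym (cancel x m n))

      drop-++ : ∀ (l : List A) {m n} → l ++ m ↭ l ++ n → m ↭ n
      drop-++ []      r = r
      drop-++ (x ∷ l) r = drop-++ l (drop-mid [] [] r)

      -- The one-element subset containing the generator `x`. Invariance follows by adding `n` to
      -- both sides and cancelling it.
      singleton : A → Invariant
      singleton x = (λ (m , n) → Trunc 1 (m ↭ x ∷ n) , trunc-hlevel 1 _) ,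
        λ (m , n) (m′ , n′) r → trunc₁-map λ s → drop-++ n
          (↭-trans (++-comm n m′) (↭-trans (↭-sym r)
            (↭-trans (++⁺ʳ n′ s) (↭-trans (prep x (++-comm n n′))
              (++-comm (x ∷ n′) n)))))

    -- Each element of A acts on the subsets above by translation; since A is
    -- acyclic all these translations coincide, but translating by x and by y
    -- gives different subsets unless x ≡ y.
    acyclic-connected : isAcyclic A → (x y : A) → Trunc 1 (x ≡ y)
    -- The subset of `y` translated by `y` contains zero, so its translate by `x` does too, which
    -- means that `x ∷ []` is a permutation of `y ∷ []`.
    acyclic-connected hA x y = trunc₁-map (λ r → ∷-injectiveˡ (↭-singleton-inv r))
      (subst (λ e → proj₁ (proj₁ (e (singleton y)) ([] , [])))
        (trans (H y) (sym (H x))) ∣ ↭-refl ∣)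
      where
      H : ∀ x → shift⁺ x ≡ _
      H = proj₂ (equiv-constant hA shift⁺ shift⁺-isEquiv)

  -- Torsors over an abelian group.

  module Torsors (G : Group ℓ) (G-abelian : isAbelian G) where

    open Group G
    open GroupProperties bundle using (∙-cancelʳ)
    open ≡-Reasoning

    private
      comm : ∀ g h → g ∙ h ≡ h ∙ g
      comm = IsAbelianGroup.comm G-abelian

      swap : ∀ g h k → g ∙ (h ∙ k) ≡ h ∙ (g ∙ k)
      swap g h k = trans (sym (assoc g h k)) (trans (cong (_∙ k) (comm g h)) (assoc h g k))

    -- The unit law is a consequence: if `g · s ≡ s`, then `ε · s ≡ ε · (g · s) ≡ (ε ∙ g) · s ≡ s`.
    IsTorsor : (T : Set ℓ) → (Carrier → T → T) → Set ℓ
    IsTorsor T _·_ =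
      isSet T × Trunc 1 T × (∀ g h t → (g ∙ h) · t ≡ g · (h · t)) ×
      (∀ s t → isContr (Σ[ g ∈ Carrier ] g · s ≡ t))

    isProp-IsTorsor : {T : Set ℓ} (α : Carrier → T → T) → isProp (IsTorsor T α)
    isProp-IsTorsor α u@(hT , _) v = isProp-× isProp-isSet (isProp-× (trunc-hlevel 1 _) (isProp-×
      (isProp-Π λ _ → isProp-Π λ _ → isProp-Π λ _ → hT _ _)
      (isProp-Π λ _ → isProp-Π λ _ → isProp-isContr))) u v

    Torsor : Set (lsuc ℓ)
    Torsor = Σ[ T ∈ Set ℓ ] Σ (Carrier → T → T) (IsTorsor T)

    infixr 7 act
    act : (T : Torsor) → Carrier → proj₁ T → proj₁ T
    act T = proj₁ (proj₂ T)

    syntax act T g t = g ·[ T ] t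

    module _ (T : Torsor) where

      isSetTorsor : isSet (proj₁ T)
      isSetTorsor = proj₁ (proj₂ (proj₂ T))

      torsor-inhabited : Trunc 1 (proj₁ T)
      torsor-inhabited = proj₁ (proj₂ (proj₂ (proj₂ T)))

      act-∙ : ∀ g h t → (g ∙ h) ·[ T ] t ≡ g ·[ T ] h ·[ T ] t
      act-∙ = proj₁ (proj₂ (proj₂ (proj₂ (proj₂ T))))

      difference : ∀ s t → isContr (Σ[ g ∈ Carrier ] g ·[ T ] s ≡ t)
      difference = proj₂ (proj₂ (proj₂ (proj₂ (proj₂ T))))

      act-swap : ∀ g h t → g ·[ T ] h ·[ T ] t ≡ h ·[ T ] g ·[ T ] t
      act-swap g h t = trans (sym (act-∙ g h t)) (trans (cong (λ k → act T k t) (comm g h)) (act-∙ h g t))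

      act-injective : ∀ {g h} t → g ·[ T ] t ≡ h ·[ T ] t → g ≡ h
      act-injective {g} {h} t p =
        cong proj₁ (isContr→isProp (difference t (act T h t)) (g , p) (h , refl))

    module _ (S T : Torsor) where

      IsEquivariant : (proj₁ S → proj₁ T) → Set ℓ
      IsEquivariant φ = ∀ g s → φ (g ·[ S ] s) ≡ g ·[ T ] φ s

      Hom : Set ℓ
      Hom = Σ (proj₁ S → proj₁ T) IsEquivariant

      isProp-IsEquivariant : ∀ φ → isProp (IsEquivariant φ)
      isProp-IsEquivariant φ = isProp-Π λ _ → isProp-Π λ _ → isSetTorsor T _ _

      Hom-≡ : {φ ψ : Hom} → (∀ s → proj₁ φ s ≡ proj₁ ψ s) → φ ≡ ψ
      Hom-≡ h = Σ≡Prop isProp-IsEquivariant (funext h)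

      Hom-≡-at : {φ ψ : Hom} → ∀ s → proj₁ φ s ≡ proj₁ ψ s → φ ≡ ψ
      Hom-≡-at {φ , hφ} {ψ , hψ} s p = Hom-≡ λ s′ →
        let (g , q) = proj₁ (difference S s s′) in begin
          φ s′              ≡⟨ cong φ q ⟨
          φ (g ·[ S ] s)    ≡⟨ hφ g s ⟩
          g ·[ T ] φ s      ≡⟨ cong (act T g) p ⟩
          g ·[ T ] ψ s      ≡⟨ hψ g s ⟨
          ψ (g ·[ S ] s)    ≡⟨ cong ψ q ⟩
          ψ s′              ∎

      hom-through : proj₁ S → proj₁ T → Hom
      hom-through s₀ t₀ =
        (λ s → act T (proj₁ (proj₁ (difference S s₀ s))) t₀) , λ g s →
          let (k , p) = proj₁ (difference S s₀ (act S g s))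
              (l , q) = proj₁ (difference S s₀ s) in
          trans (cong (λ h → act T h t₀) (act-injective S s₀ (begin
            k ·[ S ] s₀            ≡⟨ p ⟩
            g ·[ S ] s             ≡⟨ cong (act S g) q ⟨
            g ·[ S ] l ·[ S ] s₀   ≡⟨ act-∙ S g l s₀ ⟨
            (g ∙ l) ·[ S ] s₀      ∎)))
            (act-∙ T g l t₀)

      -- This is the difference of `T` and `S`. Commutativity of `G` makes `action g φ` equivariant.
      Hom-torsor : Torsor
      Hom-torsor = Hom , action , isSet-ΣProp (isSet-Π λ _ → isSetTorsor T) isProp-IsEquivariant ,
        trunc₁-rec (trunc-hlevel 1 _) (λ s → trunc₁-map (hom-through s) (torsor-inhabited T))
          (torsor-inhabited S) ,
        (λ g h (φ , _) → Hom-≡ λ s → act-∙ T g h (φ s)) ,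
        λ φ ψ → trunc₁-rec isProp-isContr (unique-difference φ ψ) (torsor-inhabited S)
        where
        action : Carrier → Hom → Hom
        action g (φ , h) = (λ s → g ·[ T ] φ s) , λ k s →
          trans (cong (act T g) (h k s)) (act-swap T g k (φ s))

        unique-difference : ∀ φ ψ → proj₁ S → isContr (Σ[ g ∈ Carrier ] action g φ ≡ ψ)
        unique-difference φ ψ s =
          let ((g , p) , u) = difference T (proj₁ φ s) (proj₁ ψ s) in
          (g , Hom-≡-at s p) , λ (h , q) →
            Σ≡Prop (λ k → isSet-ΣProp (isSet-Π λ _ → isSetTorsor T) isProp-IsEquivariant
                     (action k φ) ψ)
              (cong proj₁ (u (h , cong (λ χ → proj₁ χ s) q)))

      Hom-isEquiv : ((φ , _) : Hom) → isEquiv φ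
      Hom-isEquiv (φ , h) t = trunc₁-rec isProp-isContr (λ s₀ →
        let (g , p) = proj₁ (difference T (φ s₀) t) in
        (g ·[ S ] s₀ , trans (h g s₀) p) , λ (s , q) →
          let (k , r) = proj₁ (difference S s₀ s) in
          Σ≡Prop (λ _ → isSetTorsor T _ _) (begin
            g ·[ S ] s₀   ≡⟨ cong (λ l → act S l s₀) (act-injective T (φ s₀) (begin
                               g ·[ T ] φ s₀     ≡⟨ p ⟩
                               t                 ≡⟨ q ⟨
                               φ s               ≡⟨ cong φ r ⟨
                               φ (k ·[ S ] s₀)   ≡⟨ h k s₀ ⟩
                               k ·[ T ] φ s₀     ∎)) ⟩
            k ·[ S ] s₀   ≡⟨ r ⟩
            s             ∎)) (torsor-inhabited S)

      Hom→≡ : Hom → S ≡ T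
      Hom→≡ (φ , h) = path (ua e) λ g s → begin
        proj₁ (idToEquiv (ua e)) (g ·[ S ] s)   ≡⟨ cong (λ e → proj₁ e (act S g s)) (ua-β e) ⟩
        φ (g ·[ S ] s)                          ≡⟨ h g s ⟩
        g ·[ T ] φ s                            ≡⟨ cong (λ e → act T g (proj₁ e s)) (ua-β e) ⟨
        g ·[ T ] proj₁ (idToEquiv (ua e)) s     ∎
        where
        e : proj₁ S ≃ proj₁ T
        e = φ , Hom-isEquiv (φ , h)

        path : {U : Set ℓ} {σ : Σ (Carrier → U → U) (IsTorsor U)} (q : proj₁ S ≡ U) →
               (∀ g s → proj₁ (idToEquiv q) (g ·[ S ] s) ≡ proj₁ σ g (proj₁ (idToEquiv q) s)) →
               S ≡ (U , σ)
        path refl H = cong (proj₁ S ,_) (Σ≡Prop isProp-IsTorsor (funext λ g → funext (H g)))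

    -- Evaluation is an equivariant map from `S` to its double dual, and equivariant maps of torsors
    -- are identifications.
    Hom-involutive : ∀ S T → Hom-torsor (Hom-torsor S T) T ≡ S
    Hom-involutive S T = sym (Hom→≡ S (Hom-torsor (Hom-torsor S T) T)
      ((λ s → (λ (φ , _) → φ s) , λ _ _ → refl) ,
       λ g s → Hom-≡ (Hom-torsor S T) T λ (φ , h) → h g s))

    Hom-torsor-isEquiv : ∀ T → isEquiv (λ S → Hom-torsor S T)
    Hom-torsor-isEquiv T = inverse→isEquiv (λ S → Hom-torsor S T) (λ S → Hom-torsor S T)
      (λ S → Hom-involutive S T) (λ S → Hom-involutive S T)

    -- Stands in for the delooping of the type of torsors: the classifying map of
    -- T is recovered from the autoequivalences S ↦ Hom S (T z) of that type.
    torsor-transport : {A : Set a} → isAcyclic A → (T : A → Torsor) →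
                       ∀ {x} (p : x ≡ x) (t : proj₁ (T x)) → subst (proj₁ ∘ T) p t ≡ t
    torsor-transport hA T {x} p t = begin
      subst (proj₁ ∘ T) p t                   ≡⟨ evaluate p (id , λ _ _ → refl) ⟨
      proj₁ (subst Y p (id , λ _ _ → refl)) t ≡⟨ cong (λ φ → proj₁ φ t) (transport-constant K p (id , λ _ _ → refl)) ⟩
      t                                       ∎
      where
      -- Transporting the identity map in `Y` computes transport in `T` (`evaluate`), while `Y` is a
      -- constant family, its members being values at `T x` of the same autoequivalence.
      Y : _ → Set ℓ
      Y z = Hom (T x) (T z)

      translations : IsConstant (λ z S → Hom-torsor S (T z))
      translations = equiv-constant hA (λ z S → Hom-torsor S (T z)) (λ z → Hom-torsor-isEquiv (T z))

      K : ∀ z → Y z ≡ proj₁ (proj₁ translations (T x))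
      K z = cong (λ e → proj₁ (e (T x))) (proj₂ translations z)

      evaluate : ∀ {z} (p : x ≡ z) (φ : Y x) → proj₁ (subst Y p φ) t ≡ subst (proj₁ ∘ T) p (proj₁ φ t)
      evaluate refl _ = refl

    -- Homomorphisms from loops of an acyclic type to an abelian group.

    module _ {A : Set ℓ} (hA : isAcyclic A) (x : A) (θ : x ≡ x → Carrier)
             (θ-hom : ∀ p q → θ (trans p q) ≡ θ p ∙ θ q) where

      private
        -- The bundle of torsors over `A` with monodromy `θ`; over `x` it has `θ` itself as a point.
        Fibre : A → Set ℓ
        Fibre z = Σ[ t ∈ (x ≡ z → Carrier) ] (∀ p q → t (trans p q) ≡ θ p ∙ t q)

        Fibre-≡ : ∀ {z} {s t : Fibre z} → (∀ q → proj₁ s q ≡ proj₁ t q) → s ≡ t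
        Fibre-≡ h = Σ≡Prop (λ _ → isProp-Π λ _ → isProp-Π λ _ → isSetCarrier _ _) (funext h)

        isSet-Fibre : ∀ {z} → isSet (Fibre z)
        isSet-Fibre = isSet-ΣProp (isSet-Π λ _ → isSetCarrier)
          (λ _ → isProp-Π λ _ → isProp-Π λ _ → isSetCarrier _ _)

        action : ∀ {z} → Carrier → Fibre z → Fibre z
        action g (t , h) = (λ q → g ∙ t q) , λ p q → trans (cong (g ∙_) (h p q)) (swap g (θ p) (t q))

        unique-difference : (s t : Fibre x) → isContr (Σ[ g ∈ Carrier ] action g s ≡ t)
        unique-difference (s , hs) (t , ht) = (g , Fibre-≡ agree) , λ (k , r) →
          Σ≡Prop (λ _ → isSet-Fibre _ _)
            (∙-cancelʳ (s refl) g k (trans g-refl (cong (λ u → proj₁ u refl) (sym r))))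
          where
          g : Carrier
          g = t refl ∙ s refl ⁻¹

          g-refl : g ∙ s refl ≡ t refl
          g-refl = trans (assoc _ _ _) (trans (cong (t refl ∙_) (inverseˡ (s refl))) (identityʳ (t refl)))

          agree : ∀ q → g ∙ s q ≡ t q
          agree q = begin
            g ∙ s q              ≡⟨ cong (λ r → g ∙ s r) (trans-reflʳ q) ⟨
            g ∙ s (trans q refl) ≡⟨ cong (g ∙_) (hs q refl) ⟩
            g ∙ (θ q ∙ s refl)   ≡⟨ swap g (θ q) (s refl) ⟩
            θ q ∙ (g ∙ s refl)   ≡⟨ cong (θ q ∙_) g-refl ⟩
            θ q ∙ t refl         ≡⟨ ht q refl ⟨
            t (trans q refl)     ≡⟨ cong t (trans-reflʳ q) ⟩
            t q                  ∎

        torsor : A → Torsor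
        torsor z = Fibre z , action , isSet-Fibre ,
          trunc₁-map (λ { refl → θ , θ-hom }) connected ,
          (λ g h (t , _) → Fibre-≡ λ q → assoc g h (t q)) ,
          trunc₁-rec (isProp-Π λ _ → isProp-Π λ _ → isProp-isContr)
            (λ { refl → unique-difference }) connected
          where
          connected : Trunc 1 (x ≡ z)
          connected = acyclic-connected A hA x z

        subst-Fibre : ∀ {z} (p : x ≡ z) (t : Fibre x) → proj₁ (subst Fibre p t) p ≡ proj₁ t refl
        subst-Fibre refl _ = refl

      -- Transport along `p` fixes the point `θ` of `Fibre x`, yet the transported function takes at
      -- `p` the value `θ refl`.
      loop-hom-trivial : ∀ p → θ p ≡ θ refl
      loop-hom-trivial p = trans
        (cong (λ t → proj₁ t p) (sym (torsor-transport hA torsor p (θ , θ-hom))))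
        (subst-Fibre p (θ , θ-hom))

  -- Fundamental groups and maps from acyclic to hypoabelian types.

  trunc₂-encode : {A : Set a} {x y : A} → _≡_ {A = Trunc 2 A} ∣ x ∣ ∣ y ∣ → Trunc 1 (x ≡ y)
  trunc₂-encode {a = a} {A = A} {x} {y} p =
    subst id (cong proj₁ (code-β y)) (subst (proj₁ ∘ code) p
      (subst id (sym (cong proj₁ (code-β x))) ∣ refl ∣))
    where
    -- Since `hProp a` is a set, the family `Trunc 1 (x ≡ z)` in `z` extends to the 0-truncation.
    code : Trunc 2 A → hProp a
    code = trunc-elim (λ _ → hProp a) (λ _ → isSet-hProp) (λ z → Trunc 1 (x ≡ z) , trunc-hlevel 1 _)

    code-β : ∀ z → code ∣ z ∣ ≡ (Trunc 1 (x ≡ z) , trunc-hlevel 1 _)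
    code-β = trunc-β (λ _ → hProp a) (λ _ → isSet-hProp) _

  π₁-∙ : {X : Set ℓ} {x : X} (p q : x ≡ x) →
         Group._∙_ (π₁ X x) ∣ p ∣ ∣ q ∣ ≡ ∣ trans p q ∣
  π₁-∙ p q = trans (trunc-β _ _ _ p) (trunc-β _ _ _ q)

  π₁-⁻¹ : {X : Set ℓ} {x : X} (p : x ≡ x) → Group._⁻¹ (π₁ X x) ∣ p ∣ ≡ ∣ sym p ∣
  π₁-⁻¹ p = trunc-β _ _ _ p

  module _ {A X : Set ℓ} (hA : isAcyclic A) (hX : isHypoabelian X) (u : A → X) (x : A) where

    private
      image : Subgroup (π₁ X (u x))
      image = record
        { Member       = λ s → Trunc 1 (Σ[ p ∈ x ≡ x ] ∣ cong u p ∣ ≡ s)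
        ; isPropMember = λ _ → trunc-hlevel 1 _
        ; ε-closed     = ∣ refl , refl ∣
        ; ∙-closed     = λ m n → trunc₁-rec (trunc-hlevel 1 _) (λ { (p , refl) →
            trunc₁-map (λ { (q , refl) → trans p q ,
              trans (cong ∣_∣ (sym (trans-cong p))) (sym (π₁-∙ (cong u p) (cong u q))) }) n }) m
        ; ⁻¹-closed    = trunc₁-map (λ { (p , refl) →
            sym p , trans (cong ∣_∣ (sym (sym-cong p))) (sym (π₁-⁻¹ (cong u p))) })
        }

      Im Ab : Group ℓ
      Im = subgroupGroup image
      Ab = abelianization Im

      Im-≡ : {s t : Group.Carrier Im} → proj₁ s ≡ proj₁ t → s ≡ t
      Im-≡ = Σ≡Prop (λ _ → trunc-hlevel 1 _)

      ι : x ≡ x → Group.Carrier Im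
      ι p = ∣ cong u p ∣ , ∣ p , refl ∣

      quotient : Group.Carrier Im → Group.Carrier Ab
      quotient = quot (SameCoset Im)

      quotient-∙ : ∀ s t → quotient (Group._∙_ Im s t) ≡ Group._∙_ Ab (quotient s) (quotient t)
      quotient-∙ s t = sym (trans (quot-rec-β _ _ _ _ s) (quot-rec-β _ _ _ _ t))

      quotient-ι-∙ : ∀ p q → quotient (ι (trans p q)) ≡ Group._∙_ Ab (quotient (ι p)) (quotient (ι q))
      quotient-ι-∙ p q = trans
        (cong quotient (Im-≡ (trans (cong ∣_∣ (sym (trans-cong p))) (sym (π₁-∙ (cong u p) (cong u q))))))
        (quotient-∙ (ι p) (ι q))

      -- Every class in `Ab` is merely of the form `quotient (ι p)`, and `quotient ∘ ι` is a
      -- homomorphism from loops of `A` to an abelian group, hence trivial.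
      image-perfect : isPerfect Im
      image-perfect = quotient (ι refl) , quot-elimProp (SameCoset Im) _
        (λ _ → isSet-/ (SameCoset Im) _ _)
        λ (s , m) → trunc₁-rec (isSet-/ (SameCoset Im) _ _)
          (λ (p , q) → trans
            (sym (Torsors.loop-hom-trivial Ab (abelianization-isAbelian Im) hA x (quotient ∘ ι) quotient-ι-∙ p))
            (cong quotient (Im-≡ q))) m

    hypoabelian-cong-trivial : ∀ p → Trunc 1 (cong u p ≡ refl)
    hypoabelian-cong-trivial p = trunc₂-encode
      (cong proj₁ (isContr→isProp (hX (u x) image image-perfect) (ι p) (ι refl)))

  -- Simple connectedness from central loops.

  connected-section : {A : Set a} {x : A} → (∀ y → Trunc 1 (x ≡ y)) →
                      {P : A → Set b} → (∀ y → isSet (P y)) →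
                      (k : ∀ {y} → x ≡ y → P y) → (∀ p → k p ≡ k refl) → ∀ y → P y
  connected-section {x = x} connected {P} hP k k-trivial y =
    -- `P y` is only a set, so the elimination goes into the image of `k`, a proposition because `k`
    -- is constant.
    proj₁ (trunc₁-rec isProp-image (λ p → k p , ∣ p , refl ∣) (connected y))
    where
    k-constant : ∀ {y} (p q : x ≡ y) → k p ≡ k q
    k-constant p refl = k-trivial p

    isProp-image : isProp (Σ[ z ∈ P y ] Trunc 1 (Σ[ p ∈ x ≡ y ] k p ≡ z))
    isProp-image (_ , m) (_ , n) = Σ≡Prop (λ _ → trunc-hlevel 1 _)
      (trunc₁-rec (hP y _ _) (λ { (p , refl) →
        trunc₁-rec (hP y _ _) (λ { (q , refl) → k-constant p q }) n }) m)

  -- Naturality of `h` makes its value at `x` commute with all loops, so `π₁ A x` is abelian. The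
  -- class map from loops to it is then a trivial homomorphism.
  acyclic-simplyConnected : {A : Set ℓ} → isAcyclic A → (x : A) →
    ((p : x ≡ x) → Trunc 1 (Σ[ h ∈ (∀ y → y ≡ y) ] h x ≡ p)) → isSimplyConnected A
  acyclic-simplyConnected {A = A} hA x central = ∣ x ∣ ,
    trunc-elim _ (λ t → isSet→isOfHLevel₃ (trunc-hlevel 3 A ∣ x ∣ t))
      (connected-section (acyclic-connected A hA x) (λ y → trunc-hlevel 3 A ∣ x ∣ ∣ y ∣)
        (cong ∣_∣) cong-trivial)
    where
    open Group (π₁ A x) using (_∙_)

    isSet→isOfHLevel₃ : {B : Set a} → isSet B → isOfHLevel 3 B
    isSet→isOfHLevel₃ h y z = isProp→isSet (h y z)

    commute : (h : ∀ y → y ≡ y) {y z : A} (q : y ≡ z) → trans (h y) q ≡ trans q (h z)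
    commute h refl = trans-reflʳ (h _)

    π₁-comm : ∀ s t → s ∙ t ≡ t ∙ s
    π₁-comm = trunc-elim _ (λ _ → isProp→isSet (isProp-Π λ _ → trunc-hlevel 2 _ _ _)) λ p →
      trunc-elim _ (λ _ → isProp→isSet (trunc-hlevel 2 _ _ _)) λ q →
      trunc₁-rec (trunc-hlevel 2 _ _ _)
        (λ { (h , refl) → trans (π₁-∙ (h x) q) (trans (cong ∣_∣ (commute h q)) (sym (π₁-∙ q (h x)))) })
        (central p)

    cong-trivial : ∀ p → cong ∣_∣ p ≡ refl
    -- The identity types of `Trunc 3 A` are sets, so `cong ∣_∣` factors through `π₁ A x`, where `p`
    -- and `refl` have the same class.
    cong-trivial p = trans (sym (trunc-β _ _ _ p))
      (trans (cong (trunc-elim (λ _ → _≡_ {A = Trunc 3 A} ∣ x ∣ ∣ x ∣) (λ _ → trunc-hlevel 3 A _ _) (cong ∣_∣))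
        (Torsors.loop-hom-trivial (π₁ A x) (record { isGroup = Group.isGroup (π₁ A x) ; comm = π₁-comm })
          hA x ∣_∣ (λ p q → sym (π₁-∙ p q)) p))
      (trunc-β _ _ _ refl))

  -- Constancy of maps into hypoabelian types.

  module _ (plus : PlusPrinciple ℓ) where

    acyclicMap-isEquiv : {X Q : Set ℓ} → isHypoabelian X → (j : X → Q) → isAcyclicMap j → isEquiv j
    acyclicMap-isEquiv {X} {Q} hX j hj q = trunc₁-rec isProp-isContr
      (λ w → plus (fiber j q) (hj q) (acyclic-simplyConnected (hj q) w (central w)))
      (acyclic-inhabited (hj q))
      where
      F : Set _
      F = fiber j q

      -- A loop of F over refl is an element of π₂(Q), which acts on all of F.
      family : ∀ {x} (r : j x ≡ q) (ω : r ≡ r) →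
               Σ[ h ∈ ((y : F) → y ≡ y) ] h (x , r) ≡ cong (x ,_) ω
      family refl ω = (λ (z , s) → cong (z ,_) (whisker s)) , cong (cong (_ ,_)) (whisker-refl ω)
        where
        whisker : ∀ {z} (s : z ≡ q) → s ≡ s
        whisker s = trans (sym (trans-reflʳ s)) (trans (cong (trans s) ω) (trans-reflʳ s))
        whisker-refl : (ω : refl ≡ refl) → trans (cong id ω) refl ≡ ω
        whisker-refl ω = trans (trans-reflʳ _) (cong-id ω)

      -- Exactness of the fiber sequence: what becomes trivial in `X` comes from `Q`. Splitting `p`
      -- into `over` and `pair` frees its first component, so that `go` can match on `e`.
      vertical : ∀ {x} {r s : j x ≡ q} (p : _≡_ {A = F} (x , r) (x , s)) →
                 cong proj₁ p ≡ refl → Σ[ ω ∈ r ≡ s ] cong (x ,_) ω ≡ p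
      vertical {x} {r} p e = let (ω , e′) = go (cong proj₁ p) e (over p) in ω , trans e′ (pair-η p)
        where
        over : ∀ {w w′ : F} (p : w ≡ w′) → subst (λ z → j z ≡ q) (cong proj₁ p) (proj₂ w) ≡ proj₂ w′
        over refl = refl

        pair : ∀ {w w′ : F} (p : proj₁ w ≡ proj₁ w′) →
               subst (λ z → j z ≡ q) p (proj₂ w) ≡ proj₂ w′ → w ≡ w′
        pair {z , _} refl o = cong (z ,_) o

        pair-η : ∀ {w w′ : F} (p : w ≡ w′) → pair (cong proj₁ p) (over p) ≡ p
        pair-η refl = refl

        go : ∀ {s} (p : x ≡ x) → p ≡ refl → (o : subst (λ z → j z ≡ q) p r ≡ s) →
             Σ[ ω ∈ r ≡ s ] cong (x ,_) ω ≡ pair {x , r} {x , s} p o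
        go _ refl o = o , refl

      central : (w : F) (p : w ≡ w) → Trunc 1 (Σ[ h ∈ ((y : F) → y ≡ y) ] h w ≡ p)
      central (x , r) p = trunc₁-map
        (λ e → let (ω , e′) = vertical p e ; (h , e″) = family r ω in h , trans e″ e′)
        (hypoabelian-cong-trivial (hj q) hX proj₁ (x , r) p)

    hypoabelian-constant : {A X : Set ℓ} → isAcyclic A → isHypoabelian X → (u : A → X) → IsConstant u
    hypoabelian-constant hA hX u =
      let ((x , r) , h) = acyclicMap-isEquiv hX inl (cofiber-inl-acyclic hA u) (inr tt)
      in x , λ z → sym (cong proj₁ (h (u z , glue z)))

-- Orthogonality, reduced to fibers.

corollary5p3 : ⦃ hits : HITs ⦄ (univalence : (κ : Level) → Univalence κ)
    (ℓ : Level) → PlusPrinciple ℓ →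
    {A B X Y : Set ℓ} (f : A → B) (g : X → Y) →
    isAcyclicMap f → isHypoabelianMap g → f ⊥ g
corollary5p3 univalence ℓ plus {A} {B} {X} {Y} f g hf hg u v σ =
  -- Diagonal lifts are a retract of the constancy data for `point` over all `y`: the common values
  -- give the diagonal and the lower triangle, the paths to them the upper triangle and the pasting.
  isContr-retract from-fibres to-fibres section
    (isContr-Π λ y → IsConstant-contr (hf y) (hypoabelian-constant plus (hf y) (hg (v y)) point))
  where
  open Acyclic univalence
  open Extensionality univalence

  point : ∀ {y} → fiber f y → fiber g (v y)
  point (x , refl) = u x , σ x

  Fibres : Set ℓ
  Fibres = ∀ y → IsConstant (point {y})

  Triangles : (x : A) → fiber g (v (f x)) → Set ℓ
  Triangles x (z , r) = Σ[ p ∈ u x ≡ z ] trans (cong g p) r ≡ σ x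

  split : ∀ {x w} → point (x , refl) ≡ w → Triangles x w
  split refl = refl , refl

  join : ∀ {x} w → Triangles x w → point (x , refl) ≡ w
  join (_ , _) (refl , refl) = refl

  split-join : ∀ {x} w (t : Triangles x w) → split (join w t) ≡ t
  split-join (_ , _) (refl , refl) = refl

  from-fibres : Fibres → DiagonalLift f g u v σ
  from-fibres k =
    (λ y → proj₁ (proj₁ (k y))) , (λ x → proj₁ (split (proj₂ (k (f x)) (x , refl)))) ,
    (λ y → proj₂ (proj₁ (k y))) , (λ x → proj₂ (split (proj₂ (k (f x)) (x , refl))))

  to-fibres : DiagonalLift f g u v σ → Fibres
  to-fibres (d , upper , lower , triangle) y = (d y , lower y) ,
    λ { (x , refl) → join (d (f x) , lower (f x)) (upper x , triangle x) }

  section : ∀ l → from-fibres (to-fibres l) ≡ l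
  section (d , upper , lower , triangle) =
    cong (λ t → d , proj₁ ∘ t , lower , proj₂ ∘ t)
      (funext λ x → split-join (d (f x) , lower (f x)) (upper x , triangle x))
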